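{- Let $G$ be a finite simple graph and let $e$ be an arbitrary edge of $G$. Then $\chi_\rho(G-e) \geq \frac{\chi_\rho(G)+1}{2}$. Moreover, the bound is sharp: there exist graphs $G$ with an edge $e$ for which $\chi_\rho(G-e) = \frac{\chi_\rho(G)+1}{2}$.
   Context: All graphs are finite and simple. For a positive integer $i$, an $i$-packing in $G$ is a set of vertices whose pairwise distances in $G$ are greater than $i$. A $k$-packing coloring of $G$ is a map $c:V(G)\to\{1,\ldots,k\}$ such that $c(u)=c(v)=i$ with $u\neq v$ implies $d_G(u,v)>i$ (i.e., each color class $i$ is an $i$-packing); distances in a disconnected graph between different components are infinite. The packing chromatic number $\chi_\rho(G)$ is the smallest $k$ for which $G$ has a $k$-packing coloring. $G-e$ denotes the graph obtained by deleting the edge $e$.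
   Formalization: The inequality is stated for edges e such that G−e still has at least one edge; if e is the only edge of G, then χρ(G)=2 and χρ(G−e)=1, so the bound 1 ≥ 3/2 fails (e.g. G = K₂). -}

module Defs where

open import Data.Empty using (⊥-elim)
open import Data.Fin using (Fin; zero; suc; toℕ)
import Data.Fin.Properties as Fin
open import Data.Nat using (ℕ; zero; suc; _≤_; _<_; z≤n; s≤s)
import Data.Nat.Properties as ℕ
open import Data.Product using (∃; _×_; _,_; proj₁; proj₂)
open import Data.Sum using (_⊎_; inj₁; inj₂)
open import Data.Vec.Functional using ([]; _∷_)
open import Function using (_∘_)
open import Level using (0ℓ)
open import Relation.Binary using (Rel; Decidable; Symmetric)
open import Relation.Binary.PropositionalEquality using (_≡_; _≢_; _≗_; refl; sym; trans; subst)
open import Relation.Nullary using (¬_; Dec; yes; no)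
open import Relation.Nullary.Decidable using (map′; ¬?; _×-dec_; _⊎-dec_; _→-dec_)
import Relation.Unary as U

-- Decidability of adjacency is part of what "finite graph" means
-- constructively; classically it is no restriction.
record Graph (n : ℕ) : Set₁ where
  field
    Adj        : Rel (Fin n) 0ℓ
    adj?       : Decidable Adj
    adj-sym    : Symmetric Adj
    adj-irrefl : ∀ {u} → ¬ Adj u u

open Graph public

record Edge {n : ℕ} (G : Graph n) : Set where
  constructor edge
  field
    end₁ end₂ : Fin n
    adjacent  : Adj G end₁ end₂

open Edge public

-- Fin k stands for the colours {1,…,k}: j : Fin k is the colour 1 + toℕ j.
colour : ∀ {k} → Fin k → ℕ
colour j = suc (toℕ j)

module _ {n : ℕ} where

  Joins : {G : Graph n} → Edge G → Fin n → Fin n → Set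
  Joins e x y = (x ≡ end₁ e × y ≡ end₂ e) ⊎ (x ≡ end₂ e × y ≡ end₁ e)

  joins? : {G : Graph n} (e : Edge G) → Decidable (Joins e)
  joins? e x y = ((x Fin.≟ end₁ e) ×-dec (y Fin.≟ end₂ e))
             ⊎-dec ((x Fin.≟ end₂ e) ×-dec (y Fin.≟ end₁ e))

  joins-sym : {G : Graph n} (e : Edge G) → Symmetric (Joins e)
  joins-sym e (inj₁ (p , q)) = inj₂ (q , p)
  joins-sym e (inj₂ (p , q)) = inj₁ (q , p)

  infixl 6 _─_

  _─_ : (G : Graph n) → Edge G → Graph n
  G ─ e = record
    { Adj        = λ x y → Adj G x y × ¬ Joins e x y
    ; adj?       = λ x y → adj? G x y ×-dec ¬? (joins? e x y)
    ; adj-sym    = λ (a , ¬j) → adj-sym G a , ¬j ∘ joins-sym e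
    ; adj-irrefl = adj-irrefl G ∘ proj₁
    }

  data Walk (G : Graph n) : Fin n → Fin n → ℕ → Set where
    nil  : ∀ {u} → Walk G u u 0
    cons : ∀ {u v w l} → Adj G u v → Walk G v w l → Walk G u w (suc l)

  -- d_G(u,v) > i.  The distance is the infimum in ℕ ∪ {∞} of the lengths of
  -- the u-v walks, so this holds vacuously for u, v in different components.
  DistanceExceeds : Graph n → Fin n → Fin n → ℕ → Set
  DistanceExceeds G u v i = ∀ l → Walk G u v l → i < l

  IsPackingColouring : Graph n → ∀ {k} → (Fin n → Fin k) → Set
  IsPackingColouring G c =
    ∀ u v → u ≢ v → c u ≡ c v → DistanceExceeds G u v (colour (c u))

  PackingColourable : Graph n → ℕ → Set
  PackingColourable G k = ∃ λ (c : Fin n → Fin k) → IsPackingColouring G c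

IsLeast : (ℕ → Set) → ℕ → Set
IsLeast P k = P k × (∀ j → P j → k ≤ j)

least : {P : ℕ → Set} → U.Decidable P → ∀ k → P k → ∃ (IsLeast P)
least P? zero p = 0 , p , λ _ _ → z≤n
least {P} P? (suc k) p with P? 0
... | yes p₀ = 0 , p₀ , λ _ _ → z≤n
... | no ¬p₀ with least (P? ∘ suc) k p
...   | m , pm , min = suc m , pm , min′
  where
  min′ : ∀ j → P j → suc m ≤ j
  min′ zero    q = ⊥-elim (¬p₀ q)
  min′ (suc j) q = s≤s (min j q)

-- Without function extensionality, exhaustive search over functions requires
-- the predicate to respect pointwise equality.
anyFunction? : ∀ {n k} {P : (Fin n → Fin k) → Set} →
               (∀ {c d} → c ≗ d → P c → P d) → U.Decidable P → Dec (∃ P)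
anyFunction? {zero} resp P? =
  map′ (λ p → [] , p) (λ (c , p) → resp (λ ()) p) (P? [])
anyFunction? {suc n} {P = P} resp P? =
  map′ (λ (a , c , p) → a ∷ c , p)
       (λ (c , p) → c zero , c ∘ suc , resp (λ { zero → refl ; (suc _) → refl }) p)
       (Fin.any? λ a → anyFunction? {P = λ c → P (a ∷ c)}
          (λ eq → resp λ { zero → refl ; (suc i) → eq i }) (λ c → P? (a ∷ c)))

module _ {n : ℕ} (G : Graph n) where

  walk? : ∀ u v l → Dec (Walk G u v l)
  walk? u v zero    = map′ (λ { refl → nil }) (λ { nil → refl }) (u Fin.≟ v)
  walk? u v (suc l) =
    map′ (λ (_ , a , w) → cons a w) (λ { (cons a w) → _ , a , w })
         (Fin.any? λ x → adj? G u x ×-dec walk? x v l)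

  distanceExceeds? : ∀ u v i → Dec (DistanceExceeds G u v i)
  distanceExceeds? u v i =
    map′ (λ h l w → ℕ.≰⇒> λ l≤i → h (s≤s l≤i) w)
         (λ h {l} l<1+i w → ℕ.<⇒≱ (h l w) (ℕ.≤-pred l<1+i))
         (ℕ.allUpTo? (λ l → ¬? (walk? u v l)) (suc i))

  isPackingColouring? : ∀ {k} → U.Decidable (IsPackingColouring G {k})
  isPackingColouring? c =
    Fin.all? λ u → Fin.all? λ v →
      ¬? (u Fin.≟ v) →-dec ((c u Fin.≟ c v) →-dec distanceExceeds? u v (colour (c u)))

  isPackingColouring-resp : ∀ {k} {c d : Fin n → Fin k} → c ≗ d →
                            IsPackingColouring G c → IsPackingColouring G d
  isPackingColouring-resp c≗d h u v u≢v eq l w =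
    subst (λ j → colour j < l) (c≗d u)
          (h u v u≢v (trans (c≗d u) (trans eq (sym (c≗d v)))) l w)

  packingColourable? : U.Decidable (PackingColourable G)
  packingColourable? k = anyFunction? isPackingColouring-resp isPackingColouring?

  packingColourable : PackingColourable G n
  packingColourable = (λ v → v) , λ u v u≢v u≡v → ⊥-elim (u≢v u≡v)

  packingChromaticNumber : ∃ (IsLeast (PackingColourable G))
  packingChromaticNumber = least packingColourable? n packingColourable

  χρ : ℕ
  χρ = proj₁ packingChromaticNumber

  χρ-isLeast : IsLeast (PackingColourable G) χρ
  χρ-isLeast = proj₂ packingChromaticNumber

{-# OPTIONS --safe #-}

-- Let e = xy, k = χρ (G ─ e), and take a k-packing colouring of G ─ e.  Two
-- vertices u, v of colour i violate the packing condition in G only through e,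
-- i.e. (up to swapping u and v) d(u,x) + 1 + d(y,v) ≤ i in G ─ e.  If (u,v) and
-- (u′,v′) are two such conflicts with u ≠ u′ and v ≠ v′, then
-- d(u,x) + d(u′,x) > i and d(y,v) + d(y,v′) > i, and summing gives 2i < 2i.  So
-- the conflicts of colour i share one vertex, and giving it a new colour of its
-- own repairs the class.  One of the colours 1 and 2 has no conflict: colour 1
-- has one only if x and y both have colour 1, and colour 2 only if x or y has
-- colour 2.  Hence k + (k − 1) colours suffice for G.  The triangle attains the bound.
module Submission where

open import Defs
open import Data.Nat using (ℕ; _+_)
open import Data.Integer using (+_)
open import Data.Rational.Unnormalised using (_/_; _≥_; _≃_)
open import Data.Product using (Σ; _×_)

open import Data.Empty using (⊥)
open import Data.Fin using (Fin; zero; suc; join; punchOut; splitAt)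
import Data.Fin.Properties as Fin
open import Data.Integer as ℤ using (+≤+)
import Data.Integer.Properties as ℤ
open import Data.Nat using (zero; suc; _*_; _≤_; _<_; z≤n; s≤s; _≤?_)
import Data.Nat.Properties as ℕ
open import Data.Nat.Tactic.RingSolver using (solve-∀)
open import Data.Product using (∃; _,_; proj₁; proj₂)
open import Data.Rational.Unnormalised using (*≤*; *≡*)
open import Data.Sum using (_⊎_; inj₁; inj₂)
open import Data.Sum.Properties using (inj₁-injective; inj₂-injective)
open import Relation.Binary.PropositionalEquality using (_≡_; _≢_; refl; sym; trans; cong; subst; subst₂)
open import Relation.Nullary using (¬_; Dec; yes; no; contradiction)
open import Relation.Nullary.Decidable using (map′; ¬?; _×-dec_; decidable-stable)

-- Preliminaries on colour sums and walks.

join-injective : ∀ a b (s t : Fin a ⊎ Fin b) → join a b s ≡ join a b t → s ≡ t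
join-injective a b s t eq =
  trans (sym (Fin.splitAt-join a b s)) (trans (cong (splitAt a) eq) (Fin.splitAt-join a b t))

module _ {n : ℕ} {G : Graph n} where

  infixr 5 _⊕_

  _⊕_ : ∀ {u v w l m} → Walk G u v l → Walk G v w m → Walk G u w (l + m)
  nil      ⊕ q = q
  cons a p ⊕ q = cons a (p ⊕ q)

  reverse : ∀ {u v l} → Walk G u v l → Walk G v u l
  reverse nil = nil
  reverse {l = suc l} (cons a p) =
    subst (Walk G _ _) (ℕ.+-comm l 1) (reverse p ⊕ cons (adj-sym G a) nil)

edge⇒2≤colours : ∀ {n k} {G : Graph n} → Edge G → PackingColourable G k → 2 ≤ k
edge⇒2≤colours {k = zero} e (c , _) with () ← c (end₁ e)
edge⇒2≤colours {k = suc zero} {G} e (c , packing) = contradiction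
  (packing (end₁ e) (end₂ e) end₁≢end₂ (one-colour _ _) 1 (cons (adjacent e) nil))
  λ { (s≤s ()) }
  where
  end₁≢end₂ : end₁ e ≢ end₂ e
  end₁≢end₂ eq = adj-irrefl G (subst (Adj G (end₁ e)) (sym eq) (adjacent e))
  one-colour : (i j : Fin 1) → i ≡ j
  one-colour zero zero = refl
edge⇒2≤colours {k = suc (suc _)} _ _ = s≤s (s≤s z≤n)

-- Walks of `G` measured in `G ─ e`.

module _ {n : ℕ} (G : Graph n) (e : Edge G) where

  private
    H = G ─ e
    x = end₁ e
    y = end₂ e

  -- A u-v walk of G of length at most l that crosses e exactly once, from s to t.
  record Crossing (s t u v : Fin n) (l : ℕ) : Set where
    constructor crossing
    field
      {before after} : ℕ
      to-s   : Walk H u s before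
      from-t : Walk H t v after
      short  : before + suc after ≤ l

  crossing-reverse : ∀ {s t u v l} → Crossing s t u v l → Crossing t s v u l
  crossing-reverse {l = l} (crossing {p} {q} a b short) =
    crossing (reverse b) (reverse a)
      (subst (_≤ l) (trans (ℕ.+-suc p q) (trans (cong suc (ℕ.+-comm p q)) (sym (ℕ.+-suc q p)))) short)

  crossing-cons : ∀ {s t u u′ v l} → Adj H u u′ → Crossing s t u′ v l → Crossing s t u v (suc l)
  crossing-cons a (crossing p q short) = crossing (cons a p) q (s≤s short)

  crossing-weaken : ∀ {s t u v l l′} → l ≤ l′ → Crossing s t u v l → Crossing s t u v l′
  crossing-weaken l≤l′ (crossing p q short) = crossing p q (ℕ.≤-trans short l≤l′)

  data Reduced (u v : Fin n) (l : ℕ) : Set where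
    avoids : ∀ {l′} → Walk H u v l′ → l′ ≤ l → Reduced u v l
    along  : Crossing x y u v l → Reduced u v l
    back   : Crossing y x u v l → Reduced u v l

  private
    1+after≤ : ∀ p {q l} → p + suc q ≤ l → suc q ≤ l
    1+after≤ p = ℕ.≤-trans (ℕ.m≤n+m _ p)

  -- One crossing always suffices. When a step over `e` precedes a crossing in the same direction,
  -- the stretch between the two is a closed loop and is cut out. When the directions are opposite,
  -- the tail after the later crossing already starts at `u`, so both crossings disappear.
  reduce-walk : ∀ {u v l} → Walk G u v l → Reduced u v l
  reduce-walk nil = avoids nil z≤n
  reduce-walk (cons {u} {u′} a w) with joins? e u u′ | reduce-walk w
  ... | no ¬j | avoids w′ w′≤l = avoids (cons (a , ¬j) w′) (s≤s w′≤l)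
  ... | no ¬j | along r = along (crossing-cons (a , ¬j) r)
  ... | no ¬j | back r = back (crossing-cons (a , ¬j) r)
  ... | yes (inj₁ (refl , refl)) | avoids w′ w′≤l = along (crossing nil w′ (s≤s w′≤l))
  ... | yes (inj₁ (refl , refl)) | along (crossing {p} _ b short) =
    along (crossing nil b (ℕ.m≤n⇒m≤1+n (1+after≤ p short)))
  ... | yes (inj₁ (refl , refl)) | back (crossing {p} _ b short) =
    avoids b (ℕ.<⇒≤ (ℕ.m≤n⇒m≤1+n (1+after≤ p short)))
  ... | yes (inj₂ (refl , refl)) | avoids w′ w′≤l = back (crossing nil w′ (s≤s w′≤l))
  ... | yes (inj₂ (refl , refl)) | along (crossing {p} _ b short) =
    avoids b (ℕ.<⇒≤ (ℕ.m≤n⇒m≤1+n (1+after≤ p short)))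
  ... | yes (inj₂ (refl , refl)) | back (crossing {p} _ b short) =
    back (crossing nil b (ℕ.m≤n⇒m≤1+n (1+after≤ p short)))

  crossing? : ∀ s t u v l → Dec (Crossing s t u v l)
  crossing? s t u v l =
    map′ (λ (_ , _ , _ , _ , p , q , short) → crossing p q short)
         (λ (crossing {i} {j} p q short) →
            i , s≤s (ℕ.m+n≤o⇒m≤o i short) ,
            j , s≤s (ℕ.<⇒≤ (1+after≤ i short)) , p , q , short)
         (ℕ.anyUpTo? (λ i → ℕ.anyUpTo? (λ j →
            walk? H u s i ×-dec walk? H t v j ×-dec (i + suc j ≤? l)) (suc l)) (suc l))

  -- Conflicts of one colour and their common vertex.

  module _ {k : ℕ} (c : Fin n → Fin k) (packing : IsPackingColouring H c) where

    -- Only the direction from `x` to `y` is recorded; a crossing the other way becomes a conflict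
    -- of the swapped pair through `crossing-reverse`.
    Conflict : Fin k → Fin n → Fin n → Set
    Conflict i u v = c u ≡ i × c v ≡ i × Crossing x y u v (colour i)

    conflict? : ∀ i u v → Dec (Conflict i u v)
    conflict? i u v = (c u Fin.≟ i) ×-dec (c v Fin.≟ i) ×-dec crossing? x y u v (colour i)

    conflicts-share : ∀ {i u v u′ v′} → Conflict i u v → Conflict i u′ v′ →
                      u ≢ u′ → v ≢ v′ → ⊥
    conflicts-share {i} {u} {v} {u′} {v′}
      (refl , cv≡i , crossing {p} {q} a b short)
      (cu′≡i , cv′≡i , crossing {p′} {q′} a′ b′ short′) u≢u′ v≢v′ =
      ℕ.<-irrefl refl (begin-strict
        i₊ + i₊                       <⟨ ℕ.+-mono-< far-x far-y ⟩
        (p + p′) + (q + q′)           ≤⟨ ℕ.m≤n+m _ 2 ⟩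
        2 + ((p + p′) + (q + q′))     ≡⟨ regroup p p′ q q′ ⟩
        (p + suc q) + (p′ + suc q′)   ≤⟨ ℕ.+-mono-≤ short short′ ⟩
        i₊ + i₊                       ∎)
      where
      open ℕ.≤-Reasoning
      i₊ = colour i
      regroup : ∀ p p′ q q′ → 2 + ((p + p′) + (q + q′)) ≡ (p + suc q) + (p′ + suc q′)
      regroup = solve-∀
      far-x : i₊ < p + p′
      far-x = packing u u′ u≢u′ (sym cu′≡i) _ (a ⊕ reverse a′)
      far-y : i₊ < q + q′
      far-y = subst (λ j → colour j < q + q′) cv≡i
        (packing v v′ v≢v′ (trans cv≡i (sym cv′≡i)) _ (reverse b ⊕ b′))

    Covers : Fin k → Fin n → Set
    Covers i w = ∀ {u v} → Conflict i u v → u ≡ w ⊎ v ≡ w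

    -- Any two conflicts agree in their first or in their second ends. If two of them have first
    -- ends `u` and `u′` that differ, they share `v`; a third one missing `v` would need a first end
    -- equal to both `u` and `u′`.
    cover : ∀ i → ∃ (Covers i)
    cover i with Fin.any? (λ u → Fin.any? (conflict? i u))
    -- An arbitrary default, as there is nothing to cover.
    ... | no none = x , λ k → contradiction (_ , _ , k) none
    ... | yes (u , v , k)
      with Fin.any? (λ u′ → Fin.any? (λ v′ → ¬? (u Fin.≟ u′) ×-dec conflict? i u′ v′))
    ...   | no all-u = u , λ {u″} {v″} k″ →
      inj₁ (sym (decidable-stable (u Fin.≟ u″) λ u≢u″ → all-u (u″ , v″ , u≢u″ , k″)))
    ...   | yes (u′ , v′ , u≢u′ , k′) = v , covers
      where
      v≡v′ : v ≡ v′
      v≡v′ = decidable-stable (v Fin.≟ v′) (conflicts-share k k′ u≢u′)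
      covers : Covers i v
      covers {u″} {v″} k″ with v″ Fin.≟ v | u″ Fin.≟ u
      ... | yes v″≡v | _ = inj₂ v″≡v
      ... | no v″≢v | no u″≢u = contradiction v″≢v (conflicts-share k″ k u″≢u)
      ... | no v″≢v | yes refl =
        contradiction (λ v″≡v′ → v″≢v (trans v″≡v′ (sym v≡v′))) (conflicts-share k″ k′ u≢u′)

    ConflictFree : Fin k → Set
    ConflictFree i = ∀ {u v} → ¬ Conflict i u v

  -- Recolouring the covering vertices.

  module _ {m : ℕ} (c : Fin n → Fin (suc m)) (packing : IsPackingColouring H c)
           (s : Fin (suc m)) (free : ConflictFree c packing s) where

    -- The right summand holds one new colour for each old colour other than `s`, indexed by
    -- `punchOut`. A new colour goes to at most one vertex, so its numerical size is irrelevant.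
    data Recoloured (v : Fin n) : Fin (suc m) ⊎ Fin m → Set where
      kept    : (s ≢ c v → v ≢ proj₁ (cover c packing (c v))) → Recoloured v (inj₁ (c v))
      renewed : (s≢cv : s ≢ c v) → v ≡ proj₁ (cover c packing (c v)) →
                Recoloured v (inj₂ (punchOut s≢cv))

    recolour : ∀ v → ∃ (Recoloured v)
    recolour v with s Fin.≟ c v | v Fin.≟ proj₁ (cover c packing (c v))
    ... | yes s≡cv | _     = _ , kept λ s≢cv → contradiction s≡cv s≢cv
    ... | no  s≢cv | yes p = _ , renewed s≢cv p
    ... | no  _    | no ¬p = _ , kept λ _ → ¬p

    kept-no-conflict : ∀ {i u v} → Conflict c packing i u v →
                       (s ≢ i → u ≢ proj₁ (cover c packing i)) →
                       (s ≢ i → v ≢ proj₁ (cover c packing i)) → ⊥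
    kept-no-conflict {i} k ku kv with s Fin.≟ i
    ... | yes refl = free k
    ... | no s≢i with proj₂ (cover c packing i) k
    ...   | inj₁ eq = ku s≢i eq
    ...   | inj₂ eq = kv s≢i eq

    recoloured-packing : ∀ {u v a b} → Recoloured u a → Recoloured v b → u ≢ v → a ≡ b →
                         DistanceExceeds G u v (colour (join (suc m) m a))
    recoloured-packing {u} {v} (renewed s≢cu p) (renewed s≢cv q) u≢v eq =
      contradiction
        (trans p (trans (cong (λ i → proj₁ (cover c packing i))
                    (Fin.punchOut-injective s≢cu s≢cv (inj₂-injective eq))) (sym q)))
        u≢v
    -- `join` lists the old colours first, so a kept colour retains its numerical value and hence
    -- its distance requirement.
    recoloured-packing {u} {v} (kept ku) (kept kv) u≢v eq l w
      rewrite Fin.toℕ-↑ˡ (c u) m = ℕ.≰⇒> λ l≤i → absurd l≤i (reduce-walk w)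
      where
      cu≡cv : c u ≡ c v
      cu≡cv = inj₁-injective eq
      kv′ : s ≢ c u → v ≢ proj₁ (cover c packing (c u))
      kv′ = subst (λ i → s ≢ i → v ≢ proj₁ (cover c packing i)) (sym cu≡cv) kv
      absurd : l ≤ colour (c u) → Reduced u v l → ⊥
      absurd l≤i (avoids {l′} w′ l′≤l) =
        ℕ.<⇒≱ (packing u v u≢v cu≡cv l′ w′) (ℕ.≤-trans l′≤l l≤i)
      absurd l≤i (along r) =
        kept-no-conflict (refl , sym cu≡cv , crossing-weaken l≤i r) ku kv′
      absurd l≤i (back r) =
        kept-no-conflict (sym cu≡cv , refl , crossing-reverse (crossing-weaken l≤i r)) kv′ ku

    recolouring : PackingColourable G (suc m + m)
    recolouring =
      (λ v → join (suc m) m (proj₁ (recolour v))) ,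
      λ u v u≢v eq → recoloured-packing (proj₂ (recolour u)) (proj₂ (recolour v)) u≢v
        (join-injective (suc m) m _ _ eq)

  -- A colour without conflicts, and the count of colours.

  conflictFree : ∀ {m} (c : Fin n → Fin (2 + m)) (packing : IsPackingColouring H c) →
                 ∃ (ConflictFree c packing)
  conflictFree c packing with (c x Fin.≟ zero) ×-dec (c y Fin.≟ zero)
  ... | no ¬both = zero , λ where
    -- Length 1 leaves room for `e` alone, so the pair is `x`, `y`.
    (cu , cv , crossing nil nil _) → ¬both (cu , cv)
    (_ , _ , crossing nil (cons _ _) (s≤s ()))
    (_ , _ , crossing {suc p} {q} (cons _ _) _ (s≤s short)) →
      contradiction (1+after≤ p short) λ ()
  ... | yes (cx , cy) = suc zero , λ where
    -- A walk of length at most 2 over `e` starts at `x` or ends at `y`, and both have colour 1.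
    (cu , _ , crossing nil _ _) → contradiction (trans (sym cx) cu) λ ()
    (_ , cv , crossing (cons _ _) nil _) → contradiction (trans (sym cy) cv) λ ()
    (_ , _ , crossing {suc p} (cons _ _) (cons _ _) (s≤s short)) →
      contradiction (1+after≤ p short) λ { (s≤s ()) }

  -- The edge of `H` guarantees that colours 1 and 2 both exist for `conflictFree`. If `e` is the
  -- only edge of `G`, the inequality would read 3 ≤ 2.
  χρ-edge-deletion : Edge H → χρ G + 1 ≤ χρ H * 2
  χρ-edge-deletion f with χρ H | χρ-isLeast H
  ... | k | colourable , _ with edge⇒2≤colours f colourable
  χρ-edge-deletion f | suc (suc m) | (c , packing) , _ | s≤s (s≤s z≤n)
    with s , free ← conflictFree c packing = begin
      χρ G + 1               ≤⟨ ℕ.+-monoˡ-≤ 1 (proj₂ (χρ-isLeast G) _ (recolouring c packing s free)) ⟩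
      (2 + m + suc m) + 1    ≡⟨ double m ⟩
      (2 + m) * 2            ∎
    where
    open ℕ.≤-Reasoning
    double : ∀ m → (2 + m + suc m) + 1 ≡ (2 + m) * 2
    double = solve-∀

-- Sharpness.

triangle : Graph 3
triangle = record
  { Adj        = _≢_
  ; adj?       = λ u v → ¬? (u Fin.≟ v)
  ; adj-sym    = λ u≢v v≡u → u≢v (sym v≡u)
  ; adj-irrefl = λ u≢u → u≢u refl
  }

triangle-edge : Edge triangle
triangle-edge = edge zero (suc zero) λ ()

theorem2p1 : (∀ (n : ℕ) (G : Graph n) (e : Edge G) → Edge (G ─ e) →
    + χρ (G ─ e) / 1 ≥ + (χρ G + 1) / 2)
    ×
    (Σ ℕ λ n → Σ (Graph n) λ G → Σ (Edge G) λ e →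
    + χρ (G ─ e) / 1 ≃ + (χρ G + 1) / 2)
theorem2p1 =
  (λ n G e f → *≤* (subst₂ ℤ._≤_
     (trans (cong +_ (sym (ℕ.*-identityʳ _))) (ℤ.pos-* (χρ G + 1) 1))
     (ℤ.pos-* (χρ (G ─ e)) 2)
     (+≤+ (χρ-edge-deletion G e f)))) ,
  -- Exhaustive search evaluates to 3 for the triangle and to 2 for the path that remains.
  (3 , triangle , triangle-edge , *≡* refl)
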